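{- There exists a finite connected simple graph $G$ with at least one edge such that $\Pr_x(Z(n)=x)=\Pr_y(Z(n)=y)$ for every $n\in\mathbb{N}$ and all $x,y\in V(G)$, but $G$ is not vertex-transitive.
   Context: Graphs are undirected. Here $(Z(n))_{n\ge 0}$ denotes simple random walk on $G$ (at each step the walk moves to a neighbour of the current vertex chosen uniformly at random), and $\Pr_x(Z(n)=x)$ denotes the probability that simple random walk started at $x$ is at its starting vertex $x$ after $n$ steps. A graph is vertex-transitive if its automorphism group acts transitively on its vertex set. -}

module Defs where

open import Data.Fin using (Fin)
open import Data.Fin.Permutation using (Permutation′; _⟨$⟩ʳ_)
open import Data.Fin.Properties using (_≟_)
open import Data.Fin.Subset using (Subset; _∈_; ∣_∣)
open import Data.Fin.Subset.Properties using (x∈p⇒∣p-x∣<∣p∣)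
open import Data.Integer using (1ℤ)
open import Data.Nat using (ℕ; zero; suc; NonZero; >-nonZero)
open import Data.Nat.Properties using (m<n⇒0<n)
open import Data.Product using (Σ-syntax; ∃₂; _×_)
open import Data.Rational using (ℚ; 0ℚ; 1ℚ; _*_; _/_)
open import Data.Rational.Properties using (+-0-commutativeMonoid)
open import Data.Vec using (tabulate)
open import Data.Vec.Properties using (lookup∘tabulate; lookup⇒[]=)
open import Function.Bundles using (_⇔_)
open import Level using (0ℓ)
open import Relation.Binary.Core using (Rel)
open import Relation.Binary.Construct.Closure.ReflexiveTransitive using (Star)
open import Relation.Binary.Definitions using (Decidable; Irreflexive; Symmetric)
open import Relation.Binary.PropositionalEquality using (_≡_; trans)
open import Relation.Nullary using (does; yes; no)
open import Relation.Nullary.Decidable using (dec-true)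
open import Algebra.Properties.CommutativeMonoid.Sum +-0-commutativeMonoid
  using (sum-syntax)

record FiniteSimpleGraph : Set₁ where
  field
    order      : ℕ
    Adj        : Rel (Fin order) 0ℓ
    adj?       : Decidable Adj
    adj-sym    : Symmetric Adj
    adj-irrefl : Irreflexive _≡_ Adj

  Vertex : Set
  Vertex = Fin order

open FiniteSimpleGraph using (Vertex)

module _ (G : FiniteSimpleGraph) where
  open FiniteSimpleGraph G hiding (Vertex)

  HasEdge : Set
  HasEdge = ∃₂ λ x y → Adj x y

  -- Adj is symmetric, so chains of adjacent vertices are undirected walks.
  Connected : Set
  Connected = ∀ x y → Star Adj x y

  IsAutomorphism : Permutation′ order → Set
  IsAutomorphism π = ∀ x y → Adj x y ⇔ Adj (π ⟨$⟩ʳ x) (π ⟨$⟩ʳ y)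

  VertexTransitive : Set
  VertexTransitive =
    ∀ x y → Σ[ π ∈ Permutation′ order ] IsAutomorphism π × π ⟨$⟩ʳ x ≡ y

  neighbours : Vertex G → Subset order
  neighbours x = tabulate λ y → does (adj? x y)

  degree : Vertex G → ℕ
  degree x = ∣ neighbours x ∣

  adj⇒∈neighbours : ∀ {x y} → Adj x y → y ∈ neighbours x
  adj⇒∈neighbours {x} {y} a = lookup⇒[]= y (neighbours x)
    (trans (lookup∘tabulate _ y) (dec-true (adj? x y) a))

  adj⇒degree≢0 : ∀ {x y} → Adj x y → NonZero (degree x)
  adj⇒degree≢0 a = >-nonZero (m<n⇒0<n (x∈p⇒∣p-x∣<∣p∣ (adj⇒∈neighbours a)))

  -- The probability that the walk at x moves to y.  The row of an isolated
  -- vertex is zero; a connected graph with an edge has no such vertex.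
  step : Vertex G → Vertex G → ℚ
  step x y with adj? x y
  ... | yes a = _/_ 1ℤ (degree x) {{adj⇒degree≢0 a}}
  ... | no  _ = 0ℚ

  -- Pr x n y is the probability that Z(n) = y when Z(0) = x, by conditioning
  -- on the position at time n - 1.
  Pr : Vertex G → ℕ → Vertex G → ℚ
  Pr x zero y with x ≟ y
  ... | yes _ = 1ℚ
  ... | no  _ = 0ℚ
  Pr x (suc n) y = ∑[ z < order ] (Pr x n z * step z y)

{-# OPTIONS --safe #-}

-- In a d-regular graph Pr x n y is the number of n-step walks from x to y
-- divided by dⁿ, so it suffices that the number of closed n-step walks does not
-- depend on the base point.  The graph Γ is 4-regular on 12 vertices and
-- cospectral with the cuboctahedron; its adjacency matrix satisfies
-- A³ = 4 A + 4 J, J the all-ones matrix.  Multiplying by Aⁿ determines the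
-- diagonal of every power of A from those of I, A and A², which are constant.
-- It is not vertex-transitive, since some vertices lie on an edge shared by two
-- triangles and others do not.
module Submission where

open import Defs
open import Algebra.Bundles using (CommutativeRing)
import Algebra.Properties.Semiring.Exp
import Algebra.Properties.Semiring.Mult
import Algebra.Properties.Semiring.Sum
open import Data.Bool using (if_then_else_)
open import Data.Fin using (Fin; zero; suc; toℕ; #_)
import Data.Fin.Properties as Fin
open import Data.Fin.Permutation using (_⟨$⟩ʳ_)
open import Data.Integer using (1ℤ)
open import Data.List using (List; _∷_; [])
open import Data.List.Membership.DecPropositional using (_∈?_)
open import Data.List.Membership.Propositional using (_∈_)
open import Data.Nat using (ℕ; zero; suc; NonZero; _+_; _*_; _^_; _≟_)
open import Data.Nat.Properties using (+-*-semiring; *-assoc; *-comm; *-distribʳ-+)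
open import Data.Product using (Σ; _×_; _,_; ∃)
open import Data.Rational as ℚ using (ℚ; 1ℚ)
import Data.Rational.Properties as ℚ
open import Data.Vec using (Vec; lookup; _∷_; [])
open import Function.Bundles using (Equivalence; Injection)
open import Function.Properties.Inverse using (↔⇒↣)
open import Relation.Binary.Construct.Closure.ReflexiveTransitive using (Star; ε; _◅_)
open import Relation.Binary.PropositionalEquality using (_≡_; _≢_; refl; sym; trans; cong; cong₂; subst; module ≡-Reasoning)
open import Relation.Nullary using (¬_; Dec; does; yes; no)
open import Relation.Nullary.Decidable using (from-yes; from-no; _×-dec_; _→-dec_; ¬?)

open ≡-Reasoning

private
  module ℚΣ = Algebra.Properties.Semiring.Sum (CommutativeRing.semiring ℚ.+-*-commutativeRing)
  module ℚ× = Algebra.Properties.Semiring.Mult (CommutativeRing.semiring ℚ.+-*-commutativeRing)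
  module ℚ^ = Algebra.Properties.Semiring.Exp (CommutativeRing.semiring ℚ.+-*-commutativeRing)
  module ℕΣ = Algebra.Properties.Semiring.Sum +-*-semiring

-- As a multiple of `1ℚ`, so that compatibility with sums and products is a general semiring fact.
fromℕ : ℕ → ℚ
fromℕ n = n ℚ×.× 1ℚ

fromℕ-sum : ∀ {k} (f : Fin k → ℕ) → ℚΣ.sum (λ i → fromℕ (f i)) ≡ fromℕ (ℕΣ.sum f)
fromℕ-sum {zero}  f = refl
fromℕ-sum {suc k} f = begin
  fromℕ (f zero) ℚ.+ ℚΣ.sum (λ i → fromℕ (f (suc i)))   ≡⟨ cong (fromℕ (f zero) ℚ.+_) (fromℕ-sum (λ i → f (suc i))) ⟩
  fromℕ (f zero) ℚ.+ fromℕ (ℕΣ.sum (λ i → f (suc i)))   ≡⟨ ℚ×.×-homo-+ 1ℚ (f zero) _ ⟨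
  fromℕ (ℕΣ.sum f)                                      ∎

module _ (G : FiniteSimpleGraph) where
  open FiniteSimpleGraph G

  adjacency : Vertex → Vertex → ℕ
  adjacency x y = if does (adj? x y) then 1 else 0

  walks : ℕ → Vertex → Vertex → ℕ
  walks zero    x y = if does (x Fin.≟ y) then 1 else 0
  walks (suc n) x y = ℕΣ.sum (λ z → walks n x z * adjacency z y)

  module _ (d : ℕ) .{{_ : NonZero d}} (regular : ∀ x → degree G x ≡ d) where

    private
      1/d : ℚ
      1/d = 1ℤ ℚ./ d

    step-regular : ∀ x y → step G x y ≡ fromℕ (adjacency x y) ℚ.* 1/d
    step-regular x y with adj? x y
    -- The nonzero proof depends on the denominator, so `ℚ./-cong` replaces both at once.
    ... | yes a = trans (ℚ./-cong {p₁ = 1ℤ} {{adj⇒degree≢0 G a}} refl (regular x)) (sym (ℚ.*-identityˡ 1/d))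
    ... | no  _ = sym (ℚ.*-zeroˡ 1/d)

    -- Each step of the walk applies the adjacency matrix scaled by `1/d`, so one factor `1/d`
    -- leaves the sum per step and a count in ℕ remains.
    Pr-regular : ∀ n x y → Pr G x n y ≡ fromℕ (walks n x y) ℚ.* 1/d ℚ^.^ n
    Pr-regular zero x y with x Fin.≟ y
    ... | yes _ = refl
    ... | no  _ = refl
    Pr-regular (suc n) x y = begin
      ℚΣ.sum (λ z → Pr G x n z ℚ.* step G z y)
        ≡⟨ ℚΣ.sum-cong-≗ summand ⟩
      ℚΣ.sum (λ z → fromℕ (walks n x z * adjacency z y) ℚ.* 1/d ℚ^.^ suc n)
        ≡⟨ ℚΣ.*-distribʳ-sum (1/d ℚ^.^ suc n) (λ z → fromℕ (walks n x z * adjacency z y)) ⟨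
      ℚΣ.sum (λ z → fromℕ (walks n x z * adjacency z y)) ℚ.* 1/d ℚ^.^ suc n
        ≡⟨ cong (ℚ._* 1/d ℚ^.^ suc n) (fromℕ-sum (λ z → walks n x z * adjacency z y)) ⟩
      fromℕ (walks (suc n) x y) ℚ.* 1/d ℚ^.^ suc n
        ∎
      where
      open CommutativeRing ℚ.+-*-commutativeRing using (*-commutativeSemigroup)
      open import Algebra.Properties.CommutativeSemigroup *-commutativeSemigroup using (interchange)

      summand : ∀ z → Pr G x n z ℚ.* step G z y ≡ fromℕ (walks n x z * adjacency z y) ℚ.* 1/d ℚ^.^ suc n
      summand z = begin
        Pr G x n z ℚ.* step G z y
          ≡⟨ cong₂ ℚ._*_ (Pr-regular n x z) (step-regular z y) ⟩
        (fromℕ (walks n x z) ℚ.* 1/d ℚ^.^ n) ℚ.* (fromℕ (adjacency z y) ℚ.* 1/d)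
          ≡⟨ interchange (fromℕ (walks n x z)) _ _ 1/d ⟩
        (fromℕ (walks n x z) ℚ.* fromℕ (adjacency z y)) ℚ.* (1/d ℚ^.^ n ℚ.* 1/d)
          ≡⟨ cong₂ ℚ._*_ (sym (ℚ×.×1-homo-* (walks n x z) (adjacency z y))) (ℚ.*-comm (1/d ℚ^.^ n) 1/d) ⟩
        fromℕ (walks n x z * adjacency z y) ℚ.* 1/d ℚ^.^ suc n
          ∎

  -- The edge `x y` is the chord of a diamond, K₄ minus an edge, where `z` and `w` may also be
  -- adjacent. Adjacencies are interleaved with the quantifiers to prune the decision procedure.
  OnDiamond : Vertex → Set
  OnDiamond x = ∃ λ y → Adj x y × ∃ λ z → (Adj x z × Adj y z) × ∃ λ w → (Adj x w × Adj y w) × z ≢ w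

  onDiamond? : ∀ x → Dec (OnDiamond x)
  onDiamond? x =
    Fin.any? λ y → adj? x y ×-dec
    Fin.any? λ z → (adj? x z ×-dec adj? y z) ×-dec
    Fin.any? λ w → (adj? x w ×-dec adj? y w) ×-dec ¬? (z Fin.≟ w)

  automorphism-onDiamond : ∀ π → IsAutomorphism G π → ∀ {x} → OnDiamond x → OnDiamond (π ⟨$⟩ʳ x)
  automorphism-onDiamond π aut (y , xy , z , (xz , yz) , w , (xw , yw) , z≢w) =
    π ⟨$⟩ʳ y , image xy ,
    π ⟨$⟩ʳ z , (image xz , image yz) ,
    π ⟨$⟩ʳ w , (image xw , image yw) , λ eq → z≢w (Injection.injective (↔⇒↣ π) eq)
    where
    image : ∀ {u v} → Adj u v → Adj (π ⟨$⟩ʳ u) (π ⟨$⟩ʳ v)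
    image {u} {v} = Equivalence.to (aut u v)

-- With aᵢ = i, bᵢ = 4 + i, cᵢ = 8 + i and i read modulo 4:
-- aᵢ is adjacent to bᵢ, bᵢ₊₁, cᵢ, cᵢ₊₁, and bᵢ to cᵢ, cᵢ₊₂.
neighbourTable : Vec (List ℕ) 12
neighbourTable =
  (4 ∷ 5 ∷ 8 ∷  9 ∷ []) ∷ (5 ∷ 6 ∷ 9 ∷ 10 ∷ []) ∷ (6 ∷ 7 ∷ 10 ∷ 11 ∷ []) ∷ (4 ∷ 7 ∷ 8 ∷ 11 ∷ []) ∷
  (0 ∷ 3 ∷ 8 ∷ 10 ∷ []) ∷ (0 ∷ 1 ∷ 9 ∷ 11 ∷ []) ∷ (1 ∷ 2 ∷  8 ∷ 10 ∷ []) ∷ (2 ∷ 3 ∷ 9 ∷ 11 ∷ []) ∷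
  (0 ∷ 3 ∷ 4 ∷  6 ∷ []) ∷ (0 ∷ 1 ∷ 5 ∷  7 ∷ []) ∷ (1 ∷ 2 ∷  4 ∷  6 ∷ []) ∷ (2 ∷ 3 ∷ 5 ∷  7 ∷ []) ∷ []

Γ : FiniteSimpleGraph
Γ = record
  { order      = 12
  ; Adj        = Adj
  ; adj?       = adj?
  ; adj-sym    = λ {x} {y} → from-yes (Fin.all? λ x → Fin.all? λ y → adj? x y →-dec adj? y x) x y
  ; adj-irrefl = λ { {x} refl → from-yes (Fin.all? λ x → ¬? (adj? x x)) x }
  }
  where
  Adj : Fin 12 → Fin 12 → Set
  Adj x y = toℕ y ∈ lookup neighbourTable x

  adj? : ∀ x y → Dec (Adj x y)
  adj? x y = _∈?_ _≟_ (toℕ y) (lookup neighbourTable x)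

open FiniteSimpleGraph Γ using (Vertex; Adj; adj?)

Γ-regular : ∀ x → degree Γ x ≡ 4
Γ-regular = from-yes (Fin.all? λ x → degree Γ x ≟ 4)

-- In matrix form J A = 4 J. Columns matter because `walks` appends edges at the end.
Γ-columnSum : ∀ y → ℕΣ.sum (λ z → adjacency Γ z y) ≡ 4
Γ-columnSum = from-yes (Fin.all? λ y → ℕΣ.sum (λ z → adjacency Γ z y) ≟ 4)

-- On the all-ones vector the identity reads 64 = 16 + 48; orthogonally to it, it says that every
-- eigenvalue t satisfies t³ = 4 t. The proof evaluates all 144 entries.
Γ-cube : ∀ x y → walks Γ 3 x y ≡ 4 * walks Γ 1 x y + 4
Γ-cube = from-yes (Fin.all? λ x → Fin.all? λ y → walks Γ 3 x y ≟ 4 * walks Γ 1 x y + 4)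

-- This is A³ = 4 A + 4 J times Aⁿ on the right: by J A = 4 J, the constant term gains a factor 4 at
-- each step.
walks-recurrence : ∀ n x y → walks Γ (3 + n) x y ≡ 4 * walks Γ (1 + n) x y + 4 ^ (1 + n)
walks-recurrence zero    x y = Γ-cube x y
walks-recurrence (suc n) x y = begin
  ∑ (λ z → walks Γ (3 + n) x z * A z)
    ≡⟨ ℕΣ.sum-cong-≗ summand ⟩
  ∑ (λ z → 4 * (w z * A z) + 4 ^ (1 + n) * A z)
    ≡⟨ ℕΣ.∑-distrib-+ (λ z → 4 * (w z * A z)) (λ z → 4 ^ (1 + n) * A z) ⟩
  ∑ (λ z → 4 * (w z * A z)) + ∑ (λ z → 4 ^ (1 + n) * A z)
    ≡⟨ cong₂ _+_ (sym (ℕΣ.*-distribˡ-sum 4 (λ z → w z * A z))) (sym (ℕΣ.*-distribˡ-sum (4 ^ (1 + n)) A)) ⟩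
  4 * walks Γ (2 + n) x y + 4 ^ (1 + n) * ∑ A
    ≡⟨ cong (4 * walks Γ (2 + n) x y +_) (trans (cong (4 ^ (1 + n) *_) (Γ-columnSum y)) (*-comm (4 ^ (1 + n)) 4)) ⟩
  4 * walks Γ (2 + n) x y + 4 ^ (2 + n)
    ∎
  where
  ∑ : (Vertex → ℕ) → ℕ
  ∑ = ℕΣ.sum

  A w : Vertex → ℕ
  A z = adjacency Γ z y
  w z = walks Γ (1 + n) x z

  summand : ∀ z → walks Γ (3 + n) x z * A z ≡ 4 * (w z * A z) + 4 ^ (1 + n) * A z
  summand z = begin
    walks Γ (3 + n) x z * A z                ≡⟨ cong (_* A z) (walks-recurrence n x z) ⟩
    (4 * w z + 4 ^ (1 + n)) * A z            ≡⟨ *-distribʳ-+ (A z) (4 * w z) _ ⟩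
    4 * w z * A z + 4 ^ (1 + n) * A z        ≡⟨ cong (_+ 4 ^ (1 + n) * A z) (*-assoc 4 (w z) (A z)) ⟩
    4 * (w z * A z) + 4 ^ (1 + n) * A z      ∎

-- The recurrence lowers the length by two and reaches down to length 1, so lengths 1 and 2 seed the
-- two parities and length 0 stands alone. The base values are 1, 0 and 4.
closedWalks-constant : ∀ n x y → walks Γ n x x ≡ walks Γ n y y
closedWalks-constant 0 = from-yes (Fin.all? λ x → Fin.all? λ y → walks Γ 0 x x ≟ walks Γ 0 y y)
closedWalks-constant 1 = from-yes (Fin.all? λ x → Fin.all? λ y → walks Γ 1 x x ≟ walks Γ 1 y y)
closedWalks-constant 2 = from-yes (Fin.all? λ x → Fin.all? λ y → walks Γ 2 x x ≟ walks Γ 2 y y)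
closedWalks-constant (suc (suc (suc n))) x y = begin
  walks Γ (3 + n) x x                      ≡⟨ walks-recurrence n x x ⟩
  4 * walks Γ (1 + n) x x + 4 ^ (1 + n)    ≡⟨ cong (λ k → 4 * k + 4 ^ (1 + n)) (closedWalks-constant (suc n) x y) ⟩
  4 * walks Γ (1 + n) y y + 4 ^ (1 + n)    ≡⟨ walks-recurrence n y y ⟨
  walks Γ (3 + n) y y                      ∎

Γ-walkRegular : ∀ n x y → Pr Γ x n x ≡ Pr Γ y n y
Γ-walkRegular n x y = begin
  Pr Γ x n x                                        ≡⟨ Pr-regular Γ 4 Γ-regular n x x ⟩
  fromℕ (walks Γ n x x) ℚ.* (1ℤ ℚ./ 4) ℚ^.^ n       ≡⟨ cong (λ k → fromℕ k ℚ.* (1ℤ ℚ./ 4) ℚ^.^ n) (closedWalks-constant n x y) ⟩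
  fromℕ (walks Γ n y y) ℚ.* (1ℤ ℚ./ 4) ℚ^.^ n       ≡⟨ Pr-regular Γ 4 Γ-regular n y y ⟨
  Pr Γ y n y                                        ∎

-- One fixed length that serves all pairs, equal vertices included, makes connectedness a finite
-- check.
ThreeStep : Vertex → Vertex → Set
ThreeStep x y = ∃ λ u → Adj x u × ∃ λ v → Adj u v × Adj v y

threeStep? : ∀ x y → Dec (ThreeStep x y)
threeStep? x y = Fin.any? λ u → adj? x u ×-dec Fin.any? λ v → adj? u v ×-dec adj? v y

-- Holds because the entries of A³ = 4 A + 4 J are positive.
threeStep : ∀ x y → ThreeStep x y
threeStep = from-yes (Fin.all? λ x → Fin.all? λ y → threeStep? x y)

ThreeStep⇒Star : ∀ {x y} → ThreeStep x y → Star Adj x y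
ThreeStep⇒Star (_ , xu , _ , uv , vy) = xu ◅ uv ◅ vy ◅ ε

Γ-connected : Connected Γ
Γ-connected x y = ThreeStep⇒Star (threeStep x y)

Γ-hasEdge : HasEdge Γ
Γ-hasEdge = # 0 , # 4 , from-yes (adj? (# 0) (# 4))

Γ-notVertexTransitive : ¬ VertexTransitive Γ
-- Vertex 4 is b₀, whose edge to c₀ lies in triangles with a₀ and a₃; vertex 0 is a₀, each of whose
-- edges lies in just one triangle.
Γ-notVertexTransitive transitive with transitive (# 4) (# 0)
... | π , aut , π4≡0 = from-no (onDiamond? Γ (# 0))
  (subst (OnDiamond Γ) π4≡0 (automorphism-onDiamond Γ π aut (from-yes (onDiamond? Γ (# 4)))))

mainTheorem2 : Σ FiniteSimpleGraph (λ G → Connected G × HasEdge G × ((n : ℕ) (x y : FiniteSimpleGraph.Vertex G) → Pr G x n x ≡ Pr G y n y) × ¬ VertexTransitive G)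
mainTheorem2 = Γ , Γ-connected , Γ-hasEdge , Γ-walkRegular , Γ-notVertexTransitive
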